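{- Let $\mathfrak{K}$ be a family of nonempty c.e. sets and let $E^{\mathrm{ce}}$ be an equivalence relation on $\omega$ extending $=^{\mathrm{ce}}$. Then $\mathfrak{K}$ is $E^{\mathrm{ce}}$-learnable if and only if for every $W_e\in\mathfrak{K}$ there exists a tell-tale, that is, a finite set $D_{W_e}\subseteq W_e$ such that for every $W_{e'}\in\mathfrak{K}$ for which $e'\mathrel{E^{\mathrm{ce}}}e$ fails, if $D_{W_e}\subseteq W_{e'}$, then $W_{e'}\nsubseteq W_e$.
   Context: Fix a standard (acceptable) enumeration $(\varphi_e)_{e\in\omega}$ of the partial computable functions and let $W_e=\operatorname{dom}(\varphi_e)$. Write $e=^{\mathrm{ce}}e'$ iff $W_e=W_{e'}$. Equivalence relations on $\omega$ extending $=^{\mathrm{ce}}$ are arbitrary (no definability or effectivity is assumed). An enumeration of a set $A$ is a surjection $\mu:\omega\to A$; $\mu[s]$ denotes the finite string $\mu(0),\dots,\mu(s-1)$. A learner is an arbitrary function $\mathbf{M}:\omega^{<\omega}\to\omega$ (no effectivity is assumed). A family $\mathfrak{K}$ of nonempty c.e. sets is $E^{\mathrm{ce}}$-learnable if there is a learner $\mathbf{M}$ such that for every $e$ with $W_e\in\mathfrak{K}$ and every enumeration $\mu$ of $W_e$ there is $i\in\omega$ with $i\mathrel{E^{\mathrm{ce}}}e$ and $\mathbf{M}(\mu[s])=i$ for all sufficiently large $s$. -}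

module Defs where

open import Data.Fin.Base using (Fin)
open import Data.List.Base using (List; applyUpTo)
open import Data.List.Relation.Unary.All using (All)
open import Data.Nat.Base using (ℕ; zero; suc; _≤_; _<_)
open import Data.Product.Base using (∃; _×_)
open import Data.Vec.Base using (Vec; []; _∷_; lookup)
open import Data.Vec.Relation.Binary.Pointwise.Inductive using (Pointwise)
open import Function.Bundles using (_⇔_)
open import Level using (Level; 0ℓ; _⊔_) renaming (suc to lsuc)
open import Relation.Binary.Core using (Rel)
open import Relation.Binary.PropositionalEquality.Core using (_≡_)
open import Relation.Nullary.Negation.Core using (¬_)
open import Relation.Unary using (Pred; _∈_; _⊈_; _≐_; Satisfiable)

private
  variable
    a b : Level
    m n : ℕ

-- Kleene's partial recursive functions: `PRF n` is the type of definitions of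
-- n-ary ones, and `p [ xs ]↓ y` says that p converges on xs with value y.

data PRF : ℕ → Set where
  zeroᶠ : PRF n
  sucᶠ  : PRF 1
  proj  : Fin n → PRF n
  comp  : PRF m → Vec (PRF n) m → PRF n
  prec  : PRF n → PRF (suc (suc n)) → PRF (suc n)
  μmin  : PRF (suc n) → PRF n

infix 4 _[_]↓_

data _[_]↓_ : PRF n → Vec ℕ n → ℕ → Set where
  zeroᶠ↓ : {xs : Vec ℕ n} → zeroᶠ [ xs ]↓ 0
  sucᶠ↓  : {x : ℕ} → sucᶠ [ x ∷ [] ]↓ suc x
  proj↓  : {i : Fin n} {xs : Vec ℕ n} → proj i [ xs ]↓ lookup xs i
  comp↓  : {f : PRF m} {gs : Vec (PRF n) m} {xs : Vec ℕ n} {zs : Vec ℕ m} {y : ℕ} →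
           Pointwise (λ g z → g [ xs ]↓ z) gs zs → f [ zs ]↓ y →
           comp f gs [ xs ]↓ y
  prec↓₀ : {f : PRF n} {g : PRF (suc (suc n))} {xs : Vec ℕ n} {y : ℕ} →
           f [ xs ]↓ y → prec f g [ zero ∷ xs ]↓ y
  prec↓₊ : {f : PRF n} {g : PRF (suc (suc n))} {k : ℕ} {xs : Vec ℕ n} {r y : ℕ} →
           prec f g [ k ∷ xs ]↓ r → g [ k ∷ r ∷ xs ]↓ y →
           prec f g [ suc k ∷ xs ]↓ y
  μmin↓  : {f : PRF (suc n)} {xs : Vec ℕ n} {y : ℕ} →
           f [ y ∷ xs ]↓ 0 →
           (∀ z → z < y → ∃ λ w → f [ z ∷ xs ]↓ suc w) →
           μmin f [ xs ]↓ y

Computable : (ℕ → ℕ) → Set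
Computable s = ∃ λ (p : PRF 1) → ∀ n → p [ n ∷ [] ]↓ s n

dom : PRF 1 → Pred ℕ 0ℓ
dom p x = ∃ λ y → p [ x ∷ [] ]↓ y

CE : Pred ℕ 0ℓ → Set
CE A = ∃ λ (p : PRF 1) → A ≐ dom p

-- Acceptability in the usual form: a universal function plus the s-m-n
-- property.  Applying `smn` to an f that ignores its first argument shows that
-- every unary partial computable function occurs in the enumeration.

record AcceptableEnumeration : Set where
  field
    φ         : ℕ → PRF 1
    universal : ∃ λ (u : PRF 2) → ∀ e x y →
                u [ e ∷ x ∷ [] ]↓ y ⇔ φ e [ x ∷ [] ]↓ y
    smn       : (f : PRF 2) → ∃ λ (s : ℕ → ℕ) → Computable s ×
                (∀ e x y → φ (s e) [ x ∷ [] ]↓ y ⇔ f [ e ∷ x ∷ [] ]↓ y)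

-- Sets of numbers are predicates, compared extensionally by _≐_, so a family
-- of sets has to respect _≐_.

record IsFamilyOfNonemptyCESets (𝔎 : Pred (Pred ℕ 0ℓ) a) : Set (lsuc 0ℓ ⊔ a) where
  field
    respects : ∀ {A B} → A ≐ B → A ∈ 𝔎 → B ∈ 𝔎
    nonempty : ∀ {A} → A ∈ 𝔎 → Satisfiable A
    ce       : ∀ {A} → A ∈ 𝔎 → CE A

_Enumerates_ : (ℕ → ℕ) → Pred ℕ 0ℓ → Set
μ Enumerates A = (∀ n → μ n ∈ A) × (∀ x → x ∈ A → ∃ λ n → μ n ≡ x)

_↾_ : (ℕ → ℕ) → ℕ → List ℕ
μ ↾ s = applyUpTo μ s

Learner : Set
Learner = List ℕ → ℕ

module Learning (𝒜 : AcceptableEnumeration) where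

  open AcceptableEnumeration 𝒜 public

  W : ℕ → Pred ℕ 0ℓ
  W e = dom (φ e)

  _=ᶜᵉ_ : Rel ℕ 0ℓ
  e =ᶜᵉ e′ = W e ≐ W e′

  Learnable : Rel ℕ b → Pred (Pred ℕ 0ℓ) a → Set (a ⊔ b)
  Learnable E 𝔎 = ∃ λ (M : Learner) →
    ∀ e → W e ∈ 𝔎 → ∀ μ → μ Enumerates W e →
    ∃ λ i → E i e × (∃ λ s₀ → ∀ s → s₀ ≤ s → M (μ ↾ s) ≡ i)

  -- A finite set D is given by a list of its elements, D ⊆ A by All (_∈ A) D.

  IsTellTale : Rel ℕ b → Pred (Pred ℕ 0ℓ) a → ℕ → List ℕ → Set (a ⊔ b)
  IsTellTale E 𝔎 e D =
    All (_∈ W e) D ×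
    (∀ e′ → W e′ ∈ 𝔎 → ¬ E e′ e → All (_∈ W e′) D → W e′ ⊈ W e)

{-# OPTIONS --safe #-}
-- ⇒  If M learns W e, then some finite sequence σ in W e is locking: M never
-- changes its mind on an extension of σ inside W e, since otherwise inserting
-- mind changes forever yields an enumeration of W e on which M diverges; also
-- M σ E e.  The range of σ is a tell-tale: an enumeration of a W e′ ⊆ W e may
-- start with σ, so M answers M σ on it, whence e′ E e.
-- ⇐  M guesses the least e with W e ∈ 𝔎 and D e ⊆ range σ ⊆ W e.  On an
-- enumeration of W e these guesses converge to the least i with
-- D i ⊆ W e ⊆ W i, and the tell-tale property of D i forces e E i.
module Submission where

open import Defs
open import Axiom.ExcludedMiddle using (ExcludedMiddle)
open import Data.List.Base using (List; []; _∷_; _++_; [_]; length)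
open import Data.List.Membership.Propositional using () renaming (_∈_ to _∈ₗ_)
open import Data.List.Membership.Propositional.Properties
  using (∈-applyUpTo⁺; ∈-applyUpTo⁻; ∈-++⁺ʳ)
open import Data.List.Properties using (++-assoc; ++-identityʳ; length-++; ∷-injective)
open import Data.List.Relation.Unary.All as All using (All; []; _∷_)
import Data.List.Relation.Unary.All.Properties as All
open import Data.List.Relation.Unary.Any using (here)
open import Data.Nat.Base
  using (ℕ; zero; suc; _+_; _≤_; _<_; z≤n; s≤s; s<s⁻¹;
         _≤′_; ≤′-reflexive; ≤′-step)
  renaming (_⊔_ to _⊔ⁿ_)
open import Data.Nat.Induction using (<-rec)
open import Data.Nat.Properties
  using (≤-refl; ≤-reflexive; ≤-trans; ≤-total; <-cmp; ≤⇒≤′; m≤m⊔n; m≤n⊔m; m≤m+n; m≤n+m;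
         m<n⇒m<1+n; m<1+n⇒m<n∨m≡n; +-comm; module ≤-Reasoning)
open import Data.Product.Base using (∃; _×_; _,_; proj₁; proj₂)
open import Data.Sum.Base using (inj₁; inj₂)
open import Function.Base using (_∘_; const; id)
open import Function.Bundles using (_⇔_; mk⇔)
open import Level using (Level; 0ℓ; _⊔_; Lift; lift; lower)
open import Relation.Binary.Core using (Rel; _⇒_)
open import Relation.Binary.Definitions using (tri<; tri≈; tri>)
open import Relation.Binary.PropositionalEquality
  using (_≡_; _≢_; refl; sym; trans; cong; cong₂; subst; module ≡-Reasoning)
open import Relation.Binary.Structures using (IsEquivalence)
open import Relation.Nullary using (¬_; yes; no; contradiction)
open import Relation.Nullary.Decidable using (map′; decidable-stable)
open import Relation.Unary using (Pred; _∈_; _⊆_; Satisfiable)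

private
  variable
    a b p q : Level
    A : Pred ℕ 0ℓ

-- Classical choice and least witnesses.

lowerEM : ∀ b → ExcludedMiddle (a ⊔ b) → ExcludedMiddle a
lowerEM b em {P} = map′ lower lift (em {Lift b P})

-- The witness in `∃` can be projected out, so excluded middle only decides `P i`; where `P i`
-- fails, `x₀` is a dummy value.
choice : {I X : Set} {P : I → Set p} {R : I → X → Set q} → ExcludedMiddle p → X →
         (∀ i → P i → ∃ (R i)) → ∃ λ (f : I → X) → ∀ i → P i → R i (f i)
choice {P = P} {R} em x₀ h = (λ i → proj₁ (g i)) , λ i → proj₂ (g i)
  where
  g : ∀ i → ∃ λ x → P i → R i x
  g i with em {P i}
  ... | yes p = proj₁ (h i p) , λ _ → proj₂ (h i p)
  ... | no ¬p = x₀ , λ p → contradiction p ¬p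

Minimal : Pred ℕ p → Pred ℕ p
Minimal P i = P i × (∀ j → j < i → ¬ P j)

minimal-exists : ExcludedMiddle p → {P : Pred ℕ p} → ∃ P → ∃ (Minimal P)
minimal-exists em {P} (n , pn) = <-rec (λ n → P n → ∃ (Minimal P)) step n pn
  where
  step : ∀ n → (∀ {m} → m < n → P m → ∃ (Minimal P)) → P n → ∃ (Minimal P)
  step n ih pn with em {∃ λ m → m < n × P m}
  ... | yes (m , m<n , pm) = ih m<n pm
  ... | no none = n , pn , λ j j<n pj → none (j , j<n , pj)

minimal-unique : {P : Pred ℕ p} → ∀ {i j} → Minimal P i → Minimal P j → i ≡ j
minimal-unique {i = i} {j} (pi , mi) (pj , mj) with <-cmp i j
... | tri< i<j _ _ = contradiction pi (mj i i<j)
... | tri≈ _ i≡j _ = i≡j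
... | tri> _ _ j<i = contradiction pj (mi j j<i)

-- Properties that hold from some stage on.

Eventually : Pred ℕ p → Set p
Eventually P = ∃ λ s₀ → ∀ s → s₀ ≤ s → P s

eventually-× : {P : Pred ℕ p} {Q : Pred ℕ q} →
               Eventually P → Eventually Q → Eventually (λ s → P s × Q s)
eventually-× (s , f) (t , g) =
  s ⊔ⁿ t , λ u le → f u (≤-trans (m≤m⊔n s t) le) , g u (≤-trans (m≤n⊔m s t) le)

eventually-All : {X : Set} {R : X → Pred ℕ p} {xs : List X} →
                 All (λ x → Eventually (R x)) xs →
                 Eventually (λ s → All (λ x → R x s) xs)
eventually-All [] = 0 , λ _ _ → []
eventually-All (e ∷ es) with eventually-× e (eventually-All es)
... | s₀ , f = s₀ , λ s le → proj₁ (f s le) ∷ proj₂ (f s le)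

eventually-∀< : {R : ℕ → Pred ℕ p} → ∀ n → (∀ j → j < n → Eventually (R j)) →
                Eventually (λ s → ∀ j → j < n → R j s)
eventually-∀< zero h = 0 , λ _ _ _ ()
eventually-∀< {R = R} (suc n) h
  with eventually-× (h n ≤-refl) (eventually-∀< n (λ j j<n → h j (m<n⇒m<1+n j<n)))
... | s₀ , f = s₀ , g
  where
  g : ∀ s → s₀ ≤ s → ∀ j → j < suc n → R j s
  g s le j j<1+n with m<1+n⇒m<n∨m≡n j<1+n
  ... | inj₁ j<n = proj₂ (f s le) j j<n
  ... | inj₂ refl = proj₁ (f s le)

not-eventually-not⇒frequently :
  ExcludedMiddle p → {P : Pred ℕ p} → ¬ Eventually (¬_ ∘ P) →
  ∀ n → ∃ λ s → n ≤ s × P s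
not-eventually-not⇒frequently em h n = decidable-stable em λ none →
  h (n , λ s n≤s ps → none (s , n≤s , ps))

-- Finite sequences put in front of an enumeration.

infixr 5 _⧺_

_⧺_ : List ℕ → (ℕ → ℕ) → ℕ → ℕ
([] ⧺ μ) n = μ n
((x ∷ xs) ⧺ μ) zero = x
((x ∷ xs) ⧺ μ) (suc n) = (xs ⧺ μ) n

⧺-↾ : ∀ xs μ s → (xs ⧺ μ) ↾ (length xs + s) ≡ xs ++ μ ↾ s
⧺-↾ [] μ s = refl
⧺-↾ (x ∷ xs) μ s = cong (x ∷_) (⧺-↾ xs μ s)

⧺-lookup-++ : ∀ xs ys {μ ν n} → n < length xs → (xs ⧺ μ) n ≡ ((xs ++ ys) ⧺ ν) n
⧺-lookup-++ (x ∷ xs) ys {n = zero} _ = refl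
⧺-lookup-++ (x ∷ xs) ys {n = suc n} lt = ⧺-lookup-++ xs ys (s<s⁻¹ lt)

⧺-∈ : ∀ {xs μ} → All A xs → (∀ n → μ n ∈ A) → ∀ n → (xs ⧺ μ) n ∈ A
⧺-∈ [] μ∈ n = μ∈ n
⧺-∈ (x∈ ∷ _) μ∈ zero = x∈
⧺-∈ (_ ∷ xs∈) μ∈ (suc n) = ⧺-∈ xs∈ μ∈ n

⧺-shift : ∀ xs μ n → (xs ⧺ μ) (length xs + n) ≡ μ n
⧺-shift [] μ n = refl
⧺-shift (x ∷ xs) μ n = ⧺-shift xs μ n

⧺-enumerates : ∀ {xs μ} → All A xs → μ Enumerates A → (xs ⧺ μ) Enumerates A
⧺-enumerates {xs = xs} {μ} xs∈ (μ∈ , onto) = ⧺-∈ xs∈ μ∈ , λ x x∈ →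
  let (n , μn≡x) = onto x x∈ in length xs + n , trans (⧺-shift xs μ n) μn≡x

-- `μ` fixes the members of `A` and sends every other number to `x₀`; membership is decided
-- classically, so `μ` may fail to be computable.
enumeration : ExcludedMiddle 0ℓ → Satisfiable A → ∃ (_Enumerates A)
enumeration {A = A} em (x₀ , x₀∈) = μ , μ∈ , onto
  where
  μ : ℕ → ℕ
  μ n with em {n ∈ A}
  ... | yes _ = n
  ... | no _ = x₀
  μ∈ : ∀ n → μ n ∈ A
  μ∈ n with em {n ∈ A}
  ... | yes n∈ = n∈
  ... | no _ = x₀∈
  onto : ∀ x → x ∈ A → ∃ λ n → μ n ≡ x
  onto x x∈ = x , μx≡x
    where
    μx≡x : μ x ≡ x
    μx≡x with em {x ∈ A}
    ... | yes _ = refl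
    ... | no x∉ = contradiction x∈ x∉

-- Limits of growing chains of finite sequences.

_StartsWith_ : (ℕ → ℕ) → List ℕ → Set
μ StartsWith xs = μ ↾ length xs ≡ xs

startsWith-++⁻ : ∀ {μ} xs {ys} → μ StartsWith (xs ++ ys) → μ StartsWith xs
startsWith-++⁻ [] _ = refl
startsWith-++⁻ (x ∷ xs) eq with ∷-injective eq
... | eq₀ , eqs = cong₂ _∷_ eq₀ (startsWith-++⁻ xs eqs)

↾-cong : ∀ {μ ν} s → (∀ n → n < s → μ n ≡ ν n) → μ ↾ s ≡ ν ↾ s
↾-cong zero _ = refl
↾-cong (suc s) h = cong₂ _∷_ (h 0 (s≤s z≤n)) (↾-cong s (λ n lt → h (suc n) (s≤s lt)))

⧺-startsWith : ∀ xs {μ} → (xs ⧺ μ) StartsWith xs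
⧺-startsWith [] = refl
⧺-startsWith (x ∷ xs) = cong (x ∷_) (⧺-startsWith xs)

module _ (σ : ℕ → List ℕ)
         (extends : ∀ k → ∃ λ xs → σ (suc k) ≡ σ k ++ xs)
         (long : ∀ k → k ≤ length (σ k)) where

  chain-extends : ∀ {j k} → j ≤ k → ∃ λ xs → σ k ≡ σ j ++ xs
  chain-extends j≤k = go (≤⇒≤′ j≤k)
    where
    go : ∀ {j k} → j ≤′ k → ∃ λ xs → σ k ≡ σ j ++ xs
    go {j} (≤′-reflexive refl) = [] , sym (++-identityʳ (σ j))
    go {j} (≤′-step {k} j≤k) with go j≤k | extends k
    ... | xs , eq | ys , eq′ =
      xs ++ ys , trans eq′ (trans (cong (_++ ys) eq) (++-assoc (σ j) xs ys))

  chain-limit : ∃ λ μ → ∀ k → μ StartsWith σ k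
  chain-limit = μ , λ k →
    trans (↾-cong (length (σ k)) (agree k)) (⧺-startsWith (σ k))
    where
    μ : ℕ → ℕ
    -- By `long`, position `n` lies inside `σ (suc n)`, so the padding `const 0` is never read.
    μ n = (σ (suc n) ⧺ const 0) n
    agree : ∀ k n → n < length (σ k) → μ n ≡ (σ k ⧺ const 0) n
    -- One of `σ (suc n)` and `σ k` is an initial segment of the other, and position `n` lies inside
    -- both.
    agree k n n<len with ≤-total (suc n) k
    ... | inj₁ le with chain-extends le
    ...   | xs , eq = trans (⧺-lookup-++ (σ (suc n)) xs (long (suc n)))
                            (cong (λ ys → (ys ⧺ const 0) n) (sym eq))
    agree k n n<len | inj₂ le with chain-extends le
    ...   | xs , eq = trans (cong (λ ys → (ys ⧺ const 0) n) eq)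
                            (sym (⧺-lookup-++ (σ k) xs n<len))

-- Locking sequences.

Locking : Learner → Pred ℕ 0ℓ → List ℕ → Set
Locking M A σ = ∀ τ → All A τ → M (σ ++ τ) ≡ M σ

-- `P` stands for being a correct guess. Each stage of the chain appends a mind change, if there is
-- one, and then the next value of an enumeration. The limit enumerates `A`, so `M` is constant on
-- it from some `s₀` on; a mind change appended to `σ s₀` would contradict this, so there is none.
locking-sequence :
  ExcludedMiddle 0ℓ → Satisfiable A → (M : Learner) {P : Pred ℕ p} →
  (∀ μ → μ Enumerates A → ∃ λ i → P i × Eventually (λ s → M (μ ↾ s) ≡ i)) →
  ∃ λ σ → All A σ × P (M σ) × Locking M A σ
locking-sequence {A = A} em inhabited M {P} converges =
  σ s₀ , σ∈ s₀ , subst P (sym Mσ≡i) Pi ,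
  proj₂ (proj₂ (change (σ s₀))) (trans Mστ≡i (sym Mσ≡i))
  where
  -- The implication is vacuous when `τ` is a mind change; otherwise no mind change exists and `τ`
  -- is empty.
  change : ∀ σ → ∃ λ τ → All A τ × (M (σ ++ τ) ≡ M σ → Locking M A σ)
  change σ with em {∃ λ τ → All A τ × M (σ ++ τ) ≢ M σ}
  ... | yes (τ , τ∈ , neq) = τ , τ∈ , λ eq → contradiction eq neq
  ... | no none = [] , [] , λ _ τ τ∈ → decidable-stable em λ neq → none (τ , τ∈ , neq)

  ν = proj₁ (enumeration em inhabited)
  ν-enum = proj₂ (enumeration em inhabited)

  σ : ℕ → List ℕ
  σ zero = []
  -- The entry `ν k` makes the limit exhaust `A` and makes the sequence grow even when the chosen
  -- extension is empty.
  σ (suc k) = (σ k ++ proj₁ (change (σ k))) ++ [ ν k ]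

  σ∈ : ∀ k → All A (σ k)
  σ∈ zero = []
  σ∈ (suc k) = All.++⁺ (All.++⁺ (σ∈ k) (proj₁ (proj₂ (change (σ k)))))
                       (proj₁ ν-enum k ∷ [])

  σ-long : ∀ k → k ≤ length (σ k)
  σ-long zero = z≤n
  σ-long (suc k) = begin
    suc k                          ≤⟨ s≤s (σ-long k) ⟩
    suc (length (σ k))             ≤⟨ s≤s (m≤m+n _ (length τ)) ⟩
    suc (length (σ k) + length τ)  ≡⟨ cong suc (sym (length-++ (σ k))) ⟩
    suc (length (σ k ++ τ))        ≡⟨ +-comm 1 _ ⟩
    length (σ k ++ τ) + 1          ≡⟨ sym (length-++ (σ k ++ τ)) ⟩
    length (σ (suc k))             ∎
    where
    open ≤-Reasoning
    τ = proj₁ (change (σ k))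

  limit : ∃ λ μ → ∀ k → μ StartsWith σ k
  limit = chain-limit σ (λ k → _ , ++-assoc (σ k) _ _) σ-long

  μ = proj₁ limit
  starts = proj₂ limit

  μ-enum : μ Enumerates A
  μ-enum = μ∈ , onto
    where
    μ∈ : ∀ n → μ n ∈ A
    μ∈ n = All.applyUpTo⁻ μ (length (σ (suc n)))
             (subst (All A) (sym (starts (suc n))) (σ∈ (suc n))) (σ-long (suc n))
    onto : ∀ x → x ∈ A → ∃ λ n → μ n ≡ x
    onto x x∈ with proj₂ ν-enum x x∈
    ... | k , refl with ∈-applyUpTo⁻ μ (subst (x ∈ₗ_) (sym (starts (suc k)))
                          (∈-++⁺ʳ (σ k ++ proj₁ (change (σ k))) (here refl)))
    ...   | n , _ , x≡μn = n , sym x≡μn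

  limits = converges μ μ-enum
  i = proj₁ limits
  Pi = proj₁ (proj₂ limits)
  s₀ = proj₁ (proj₂ (proj₂ limits))

  M≡i : ∀ xs → μ StartsWith xs → s₀ ≤ length xs → M xs ≡ i
  M≡i xs st le = trans (cong M (sym st)) (proj₂ (proj₂ (proj₂ limits)) (length xs) le)

  Mσ≡i : M (σ s₀) ≡ i
  Mσ≡i = M≡i (σ s₀) (starts s₀) (σ-long s₀)

  Mστ≡i : M (σ s₀ ++ proj₁ (change (σ s₀))) ≡ i
  -- This sequence is `σ (suc s₀)` without its last entry, hence also an initial segment of `μ`.
  Mστ≡i = M≡i _ (startsWith-++⁻ (σ s₀ ++ _) (starts (suc s₀)))
    (≤-trans (σ-long s₀) (≤-trans (m≤m+n _ _) (≤-reflexive (sym (length-++ (σ s₀))))))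

-- Tell-tales from learners, and learners from tell-tales.

module _ (𝒜 : AcceptableEnumeration) (𝔎 : Pred (Pred ℕ 0ℓ) a)
         {E : Rel ℕ b} (E-equiv : IsEquivalence E) where

  open Learning 𝒜
  private module E = IsEquivalence E-equiv

  locking⇒tellTale :
    ExcludedMiddle 0ℓ → IsFamilyOfNonemptyCESets 𝔎 →
    (learnable : Learnable E 𝔎) → let M = proj₁ learnable in
    ∀ {e σ} → All (_∈ W e) σ → E (M σ) e → Locking M (W e) σ → IsTellTale E 𝔎 e σ
  locking⇒tellTale em fam (M , learns) {e} {σ} σ∈ Mσ~e locks = σ∈ , conflict
    where
    conflict : ∀ e′ → W e′ ∈ 𝔎 → ¬ E e′ e → All (_∈ W e′) σ → ¬ (W e′ ⊆ W e)
    conflict e′ e′∈𝔎 ¬e′~e σ∈′ W′⊆W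
      with enumeration em (IsFamilyOfNonemptyCESets.nonempty fam e′∈𝔎)
    ... | μ , μ-enum with learns e′ e′∈𝔎 (σ ⧺ μ) (⧺-enumerates σ∈′ μ-enum)
    ...   | i , i~e′ , s₀ , conv = ¬e′~e (E.trans (E.sym i~e′) (subst (λ j → E j e) Mσ≡i Mσ~e))
      where
      open ≡-Reasoning
      Mσ≡i : M σ ≡ i
      -- Stage `length σ + s₀` is late enough for convergence on `σ ⧺ μ`, and the input there is `σ`
      -- followed by elements of `W e`, so locking applies.
      Mσ≡i = begin
        M σ                              ≡⟨ sym (locks (μ ↾ s₀)
                                                  (All.applyUpTo⁺₂ μ s₀ (λ n → W′⊆W (proj₁ μ-enum n)))) ⟩
        M (σ ++ μ ↾ s₀)                  ≡⟨ cong M (sym (⧺-↾ σ μ s₀)) ⟩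
        M ((σ ⧺ μ) ↾ (length σ + s₀))    ≡⟨ conv _ (m≤n+m s₀ (length σ)) ⟩
        i                                ∎

  learnable⇒tellTales :
    ExcludedMiddle 0ℓ → IsFamilyOfNonemptyCESets 𝔎 → Learnable E 𝔎 →
    ∀ e → W e ∈ 𝔎 → ∃ λ D → IsTellTale E 𝔎 e D
  learnable⇒tellTales em fam learnable@(M , learns) e e∈𝔎
    with locking-sequence em (IsFamilyOfNonemptyCESets.nonempty fam e∈𝔎) M (learns e e∈𝔎)
  ... | σ , σ∈ , Mσ~e , locks = σ , locking⇒tellTale em fam learnable σ∈ Mσ~e locks

  tellTales⇒learnable :
    ExcludedMiddle a → ExcludedMiddle b →
    (∀ e → W e ∈ 𝔎 → ∃ λ D → IsTellTale E 𝔎 e D) → Learnable E 𝔎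
  tellTales⇒learnable em emᵇ tellTales = M , converges
    where
    chosen : ∃ λ (D : ℕ → List ℕ) → ∀ e → W e ∈ 𝔎 → IsTellTale E 𝔎 e (D e)
    chosen = choice em [] tellTales

    D = proj₁ chosen
    D-tellTale = proj₂ chosen

    Candidate : List ℕ → Pred ℕ a
    Candidate σ e = W e ∈ 𝔎 × All (_∈ₗ σ) (D e) × All (_∈ W e) σ

    guesser : ∃ λ (M : Learner) → ∀ σ → ∃ (Candidate σ) → Minimal (Candidate σ) (M σ)
    -- The guess 0 is a default for inputs without candidates; on an enumeration of a set in `𝔎` a
    -- candidate exists at all late stages.
    guesser = choice em 0 (λ σ → minimal-exists em)

    M = proj₁ guesser
    M-minimal = proj₂ guesser

    converges : ∀ e → W e ∈ 𝔎 → ∀ μ → μ Enumerates W e →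
                ∃ λ i → E i e × Eventually (λ s → M (μ ↾ s) ≡ i)
    converges e e∈𝔎 μ (μ∈ , onto) = i , i~e , proj₁ settled , λ s le →
      let cand , smaller = proj₂ settled s le
      in minimal-unique (M-minimal (μ ↾ s) (i , cand)) (cand , smaller)
      where
      -- As `s` grows, the tell-tale clause of `Candidate (μ ↾ s) j` stays true once true, and the
      -- consistency clause stays false once false. `Limit j` is the truth value on which the whole
      -- settles.
      Limit : Pred ℕ a
      Limit j = W j ∈ 𝔎 × All (_∈ W e) (D j) × W e ⊆ W j

      limit : ∃ (Minimal Limit)
      limit = minimal-exists em {Limit} (e , e∈𝔎 , proj₁ (D-tellTale e e∈𝔎) , id)

      i = proj₁ limit
      i-limit = proj₁ (proj₂ limit)

      i~e : E i e
      i~e = let i∈𝔎 , Di⊆ , W⊆ = i-limit in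
        E.sym (decidable-stable emᵇ λ ¬e~i → proj₂ (D-tellTale i i∈𝔎) e e∈𝔎 ¬e~i Di⊆ W⊆)

      appears : ∀ {x} → x ∈ W e → Eventually (λ s → x ∈ₗ μ ↾ s)
      appears {x} x∈ with onto x x∈
      ... | n , refl = suc n , λ s n<s → ∈-applyUpTo⁺ μ n<s

      limit⇒eventually : ∀ {j} → Limit j → Eventually (λ s → Candidate (μ ↾ s) j)
      limit⇒eventually (j∈𝔎 , Dj⊆ , W⊆) with eventually-All (All.map appears Dj⊆)
      ... | s₀ , f = s₀ , λ s le → j∈𝔎 , f s le , All.applyUpTo⁺₂ μ s (λ n → W⊆ (μ∈ n))

      -- Any one stage puts `D j` inside `W e`. An element `μ n` of `W e` lies in all later
      -- segments, and one of these is contained in `W j`.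
      frequently⇒limit : ∀ {j} → (∀ n → ∃ λ s → n ≤ s × Candidate (μ ↾ s) j) → Limit j
      frequently⇒limit {j} freq with freq 0
      ... | s , _ , j∈𝔎 , Dj⊆ , _ =
        j∈𝔎 , All.map (All.lookup (All.applyUpTo⁺₂ μ s μ∈)) Dj⊆ , W⊆
        where
        W⊆ : W e ⊆ W j
        W⊆ x∈ with onto _ x∈
        ... | n , refl with freq (suc n)
        ...   | t , n<t , _ , _ , μ↾t⊆ = All.applyUpTo⁻ μ t μ↾t⊆ n<t

      settled : Eventually (λ s → Minimal (Candidate (μ ↾ s)) i)
      settled = eventually-× (limit⇒eventually i-limit)
        -- By minimality of `i`, no `j < i` satisfies `Limit`, so each is a candidate only up to
        -- some stage; finitely many such stages have a common bound.
        (eventually-∀< i λ j j<i → decidable-stable em λ ¬ev →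
          proj₂ (proj₂ limit) j j<i
            (frequently⇒limit (not-eventually-not⇒frequently em ¬ev)))

theorem3p3 : {a b : Level} → ExcludedMiddle (a ⊔ b) →
    (𝒜 : AcceptableEnumeration) → let open Learning 𝒜 in
    (𝔎 : Pred (Pred ℕ 0ℓ) a) → IsFamilyOfNonemptyCESets 𝔎 →
    (E : Rel ℕ b) → IsEquivalence E → _=ᶜᵉ_ ⇒ E →
    Learnable E 𝔎 ⇔ (∀ e → W e ∈ 𝔎 → ∃ λ D → IsTellTale E 𝔎 e D)
theorem3p3 {a} {b} em 𝒜 𝔎 fam E E-equiv _ = mk⇔
  (learnable⇒tellTales 𝒜 𝔎 E-equiv (lowerEM (a ⊔ b) em) fam)
  (tellTales⇒learnable 𝒜 𝔎 E-equiv (lowerEM b em) (lowerEM a em))
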